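{- Let $k,m,n$ be positive integers with $n\ge2$, $m\leqslant n/2$, and $t(m+j)=t(n+j)$ for all $0\leqslant j\leqslant k$. Then $$k\ll\sqrt n\,(\log n)^{3/2},$$ where the implied constant is absolute.
   Context: For $n\ge1$, $t(n)$ is the rooted planar tree of $n$: $t(1)$ is the single-vertex tree; if $n=p_1^{a_1}\cdots p_s^{a_s}$ with primes $p_1<\dots<p_s$ and $a_i\ge1$, then $t(n)$ is a root with $s$ edges ordered left to right, the $i$-th edge leading to a copy of $t(a_i)$. $f\ll g$ means $|f|\le Cg$. -}

module Defs where

open import Data.Nat using (ℕ; zero; suc; _+_; _*_; _/_)
open import Data.Nat.Divisibility using (_∣?_)
open import Data.Nat.Primality using (prime?)
open import Data.List using (List; []; _∷_; upTo; concatMap)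
open import Relation.Nullary using (yes; no)

data Tree : Set where
  node : List Tree → Tree

-- mult f q n = multiplicity of the prime p = q + 2 in n (fuel f ≥ n suffices).
mult : ℕ → ℕ → ℕ → ℕ
mult zero q n = 0
mult (suc f) q zero = 0
mult (suc f) q (suc n) with (suc (suc q)) ∣? (suc n)
... | yes _ = suc (mult f q (suc n / suc (suc q)))
... | no _ = 0

-- tree f n = t(n) computed with fuel f (f ≥ n suffices).
mutual
  tree : ℕ → ℕ → Tree
  tree zero n = node []
  tree (suc f) n = node (children f n)

  children : ℕ → ℕ → List Tree
  children f n = concatMap (λ q → child f n q) (upTo n)

  child : ℕ → ℕ → ℕ → List Tree
  child f n q with prime? (suc (suc q)) | (suc (suc q)) ∣? n
  ... | yes _ | yes _ = tree f (mult n q n) ∷ []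
  ... | _     | _     = []

t : ℕ → Tree
t n = tree n n

module Submission where

-- The tree t(x) reveals whether x is squarefree. Suppose p is a prime not dividing n − m. Along the j ≤ k for which
-- p² ∣ n + j, the numbers m + j are prime to p and nevertheless have a square factor q² with q ≥ 2. They form an
-- arithmetic progression of about k / p² terms. Small q account for only about two thirds of them since
-- ∑ 1 / q² < 2/3; for large q one fixes instead the cofactor (m + j) / q², which is small, and uses that consecutive
-- squares are far apart. If n ≤ k² and p is at most a small power of k this is a contradiction, so n − m is divisible
-- by every prime up to such a power B. Then (n − m) ^ log₂ B is a multiple of lcm(1, …, B), which is exponential
-- in B, whereas n − m ≤ k². Hence even k² ≪ n.

open import Defs
open import Data.Nat
open import Data.Nat.Coprimality using (Coprime; coprime-divisor)
open import Data.Nat.DivMod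
  using (_%_; m≡m%n+[m/n]*n; m%n≤n; m/n*n≤m; m/n*n≡m; m*n/n≡m; /-monoˡ-≤)
open import Data.Nat.Divisibility
open import Data.Nat.ListAction using (product)
open import Data.Nat.Logarithm using (⌊log₂_⌋; ⌊log₂⌋-mono-≤; ⌊log₂[2^n]⌋≡n)
open import Data.Nat.Primality
  using (Prime; prime?; prime⇒nonTrivial; prime⇒nonZero; prime⇒irreducible)
open import Data.Nat.Primality.Factorisation using (factorise)
open import Data.Nat.Properties
open import Data.Nat.Tactic.RingSolver using (solve-∀)
open import Data.Empty using (⊥)
open import Data.List using ([]; _∷_; upTo)
open import Data.List.Membership.Propositional using (lose; find)
open import Data.List.Membership.Propositional.Properties using (∈-upTo⁺)
open import Data.List.Relation.Unary.All using (_∷_)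
open import Data.List.Relation.Unary.Any using (Any; here; there)
open import Data.List.Relation.Unary.Any.Properties using (concatMap⁺; concatMap⁻)
open import Data.Product using (∃; _×_; _,_; proj₁; proj₂)
open import Data.Sum using ([_,_]′)
open import Data.Unit using (⊤; tt)
open import Function using (id)
open import Relation.Nullary using (¬_; yes; no; contradiction)
open import Relation.Nullary.Decidable using (decidable-stable)
open import Relation.Binary.PropositionalEquality

-- Square factors read off the tree

prime-divisor : ∀ n → 2 ≤ n → ∃ λ p → Prime p × p ∣ n
prime-divisor n@(suc _) 2≤n with factorise n
... | record { factors = [] ; isFactorisation = eq } = contradiction (subst (2 ≤_) eq 2≤n) λ { (s≤s ()) }
... | record { factors = p ∷ ps ; isFactorisation = eq ; factorsPrime = pp ∷ _ } =
  p , pp , divides (product ps) (trans eq (*-comm p (product ps)))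

Branching : Tree → Set
Branching (node []) = ⊥
Branching (node (_ ∷ _)) = ⊤

-- Ramified (t x) says that some prime exponent of x exceeds 1.
Ramified : Tree → Set
Ramified (node ts) = Any Branching ts

any⇒branching : ∀ {ts} → Any (λ _ → ⊤) ts → Branching (node ts)
any⇒branching (here _) = tt
any⇒branching (there _) = tt

mult-∣ : ∀ f q {n} → suc (suc q) ∣ suc n → mult (suc f) q (suc n) ≡ suc (mult f q (suc n / suc (suc q)))
mult-∣ f q {n} d with suc (suc q) ∣? suc n
... | yes _ = refl
... | no ¬d = contradiction d ¬d

child-∣ : ∀ f n q → Prime (suc (suc q)) → suc (suc q) ∣ n → child f n q ≡ tree f (mult n q n) ∷ []
child-∣ f n q pp d with prime? (suc (suc q)) | suc (suc q) ∣? n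
... | yes _ | yes _ = refl
... | yes _ | no ¬d = contradiction d ¬d
... | no ¬pp | _ = contradiction pp ¬pp

any-child : ∀ {P : Tree → Set} f n q → Any P (child f n q) → Prime (suc (suc q)) × P (tree f (mult n q n))
any-child f n q a with prime? (suc (suc q)) | suc (suc q) ∣? n
any-child f n q (here x) | yes pp | yes _ = pp , x

any-children : ∀ {P : Tree → Set} f n q → 1 ≤ n → Prime (suc (suc q)) → suc (suc q) ∣ n →
  P (tree f (mult n q n)) → Any P (children f n)
any-children {P} f n@(suc _) q _ pp d x = concatMap⁺ _ (lose (∈-upTo⁺ (≤-trans (n≤1+n _) (∣⇒≤ d)))
  (subst (Any P) (sym (child-∣ f n q pp d)) (here x)))

-- One unit of fuel already shows an edge at the root, since a ≥ 2 has a prime divisor.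
tree-branching : ∀ f a → 2 ≤ a → Branching (tree (suc f) a)
tree-branching f a 2≤a with prime-divisor a 2≤a
... | suc (suc r) , pp , d = any⇒branching (any-children f a r (≤-trans (n≤1+n _) 2≤a) pp d tt)
... | 0 , pp , _ = contradiction (prime⇒nonTrivial pp) λ ()
... | 1 , pp , _ = contradiction (prime⇒nonTrivial pp) λ ()

tree-¬branching : ∀ f a → a ≤ 1 → ¬ Branching (tree f a)
tree-¬branching (suc f) zero _ ()
tree-¬branching (suc f) (suc zero) _ ()
tree-¬branching (suc f) (suc (suc a)) (s≤s ())

mult⇒square∣ : ∀ f q n → 2 ≤ mult f q n → suc (suc q) * suc (suc q) ∣ n
mult⇒square∣ zero q n ()
mult⇒square∣ (suc f) q zero ()
mult⇒square∣ (suc f) q (suc n) h with suc (suc q) ∣? suc n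
... | yes d = m∣n/o⇒m*o∣n d (mult⇒∣ f (suc n / suc (suc q)) (s≤s⁻¹ h))
  where
  mult⇒∣ : ∀ f n → 1 ≤ mult f q n → suc (suc q) ∣ n
  mult⇒∣ zero n ()
  mult⇒∣ (suc f) zero ()
  mult⇒∣ (suc f) (suc n) h with suc (suc q) ∣? suc n
  ... | yes d = d

-- The bound 2 ≤ f gives `mult` enough fuel for the two rounds of division that are inspected.
square∣⇒mult : ∀ f q n → 2 ≤ f → 1 ≤ n → suc (suc q) * suc (suc q) ∣ n → 2 ≤ mult f q n
square∣⇒mult (suc (suc f)) q (suc n) _ _ d
  rewrite mult-∣ (suc f) q (m*n∣⇒m∣ (suc (suc q)) (suc (suc q)) d)
  with suc n / suc (suc q) in eq | m*n∣o⇒m∣o/n (suc (suc q)) (suc (suc q)) d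
... | zero | _ = contradiction (trans (sym (m/n*n≡m (m*n∣⇒m∣ (suc (suc q)) (suc (suc q)) d))) (cong (_* suc (suc q)) eq)) λ ()
... | suc n' | d' rewrite mult-∣ f q d' = s≤s (s≤s z≤n)
square∣⇒mult (suc zero) q n (s≤s ()) _ _

square∣⇒ramified : ∀ n q → 1 ≤ n → Prime (suc (suc q)) → suc (suc q) * suc (suc q) ∣ n → Ramified (t n)
square∣⇒ramified n@(suc zero) q 1≤n pp d = contradiction (∣⇒≤ d) λ { (s≤s ()) }
square∣⇒ramified n@(suc (suc f)) q 1≤n pp d =
  any-children (suc f) n q 1≤n pp (m*n∣⇒m∣ (suc (suc q)) (suc (suc q)) d)
    (tree-branching f (mult n q n) (square∣⇒mult n q n (s≤s (s≤s z≤n)) 1≤n d))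

ramified⇒square∣ : ∀ n → Ramified (t n) → ∃ λ q → suc (suc q) * suc (suc q) ∣ n
ramified⇒square∣ (suc f) r with find (concatMap⁻ (child f (suc f)) {xs = upTo (suc f)} r)
... | q , _ , a with any-child f (suc f) q a
...   | _ , br with 2 ≤? mult (suc f) q (suc f)
...     | yes h = q , mult⇒square∣ (suc f) q (suc f) h
...     | no ¬h = contradiction br (tree-¬branching f _ (s≤s⁻¹ (≰⇒> ¬h)))

-- The tree records exponents but forgets the primes: p² ∣ x yields a square factor of y, in general
-- for another prime.
square∣-transfer : ∀ {p x y} → t x ≡ t y → 1 ≤ x → Prime p → p * p ∣ x → ∃ λ q → suc (suc q) * suc (suc q) ∣ y
square∣-transfer {suc (suc r)} {x} {y} eq 1≤x pp d =
  ramified⇒square∣ y (subst Ramified eq (square∣⇒ramified x r 1≤x pp d))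
square∣-transfer {0} _ _ pp _ = contradiction (prime⇒nonTrivial pp) λ ()
square∣-transfer {1} _ _ pp _ = contradiction (prime⇒nonTrivial pp) λ ()

-- Counting with sums over initial segments

∑ : ℕ → (ℕ → ℕ) → ℕ
∑ zero f = 0
∑ (suc n) f = f n + ∑ n f

∑-mono : ∀ n {f g : ℕ → ℕ} → (∀ i → i < n → f i ≤ g i) → ∑ n f ≤ ∑ n g
∑-mono zero h = z≤n
∑-mono (suc n) h = +-mono-≤ (h n ≤-refl) (∑-mono n λ i i<n → h i (m<n⇒m<1+n i<n))

∑-const : ∀ n c → ∑ n (λ _ → c) ≡ n * c
∑-const zero c = refl
∑-const (suc n) c = cong (c +_) (∑-const n c)

∑-+ : ∀ n f g → ∑ n (λ i → f i + g i) ≡ ∑ n f + ∑ n g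
∑-+ zero f g = refl
∑-+ (suc n) f g = trans (cong (f n + g n +_) (∑-+ n f g)) (lem (f n) (g n) (∑ n f) (∑ n g))
  where
  lem : ∀ a b c d → a + b + (c + d) ≡ a + c + (b + d)
  lem = solve-∀

∑-swap : ∀ m n (f : ℕ → ℕ → ℕ) → ∑ m (λ i → ∑ n (f i)) ≡ ∑ n (λ j → ∑ m (λ i → f i j))
∑-swap zero n f = sym (trans (∑-const n 0) (*-zeroʳ n))
∑-swap (suc m) n f = trans (cong (∑ n (f m) +_) (∑-swap m n f)) (sym (∑-+ n (f m) _))

∑-split : ∀ m n f → ∑ (n + m) f ≡ ∑ m f + ∑ n (λ i → f (m + i))
∑-split m zero f = sym (+-identityʳ _)
∑-split m (suc n) f = begin
  f (n + m) + ∑ (n + m) f                      ≡⟨ cong₂ _+_ (cong f (+-comm n m)) (∑-split m n f) ⟩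
  f (m + n) + (∑ m f + ∑ n (λ i → f (m + i)))  ≡⟨ lem (f (m + n)) (∑ m f) _ ⟩
  ∑ m f + (f (m + n) + ∑ n (λ i → f (m + i)))  ∎
  where
  open ≡-Reasoning
  lem : ∀ a b c → a + (b + c) ≡ b + (a + c)
  lem = solve-∀

[_≡?_] : ℕ → ℕ → ℕ
[ a ≡? b ] with a ≟ b
... | yes _ = 1
... | no _ = 0

fibre : (ℕ → ℕ) → ℕ → ℕ → ℕ
fibre c v n = ∑ n (λ i → [ c i ≡? v ])

1≤∑-indicator : ∀ n a → a < n → 1 ≤ ∑ n (λ v → [ a ≡? v ])
1≤∑-indicator (suc n) a a<1+n with a ≟ n
... | yes _ = s≤s z≤n
... | no a≢n = 1≤∑-indicator n a (≤∧≢⇒< (s≤s⁻¹ a<1+n) a≢n)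

≤∑-fibre : ∀ c n N → (∀ i → i < n → c i < N) → n ≤ ∑ N (λ v → fibre c v n)
≤∑-fibre c n N c<N = begin
  n                                       ≡⟨ trans (∑-const n 1) (*-identityʳ n) ⟨
  ∑ n (λ _ → 1)                           ≤⟨ ∑-mono n (λ i i<n → 1≤∑-indicator N (c i) (c<N i i<n)) ⟩
  ∑ n (λ i → ∑ N (λ v → [ c i ≡? v ]))    ≡⟨ ∑-swap n N _ ⟩
  ∑ N (λ v → fibre c v n)                 ∎
  where open ≤-Reasoning

-- Blocks of length d placed at the hits are disjoint and end by n + d.
fibre-spaced : ∀ c v n d → (∀ i j → i < j → j < n → c i ≡ v → c j ≡ v → i + d ≤ j) → fibre c v n * d ≤ n + d
fibre-spaced c v n d spaced = go n ≤-refl (n + d) λ i i<n _ → +-monoˡ-≤ d (<⇒≤ i<n)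
  where
  -- Here x bounds the ends of all blocks that start below l. At a hit l the earlier blocks end by
  -- l, so l becomes the new x.
  go : ∀ l → l ≤ n → ∀ x → (∀ i → i < l → c i ≡ v → i + d ≤ x) → fibre c v l * d ≤ x
  go zero _ x _ = z≤n
  go (suc l) l<n x below with c l ≟ v
  ... | no _ = go l (<⇒≤ l<n) x λ i i<l → below i (m<n⇒m<1+n i<l)
  ... | yes hit = ≤-trans (+-monoʳ-≤ d (go l (<⇒≤ l<n) l λ i i<l e → spaced i l i<l l<n e hit))
                          (≤-trans (≤-reflexive (+-comm d l)) (below l ≤-refl hit))

-- ∑ 1 / q² over 2 ≤ q ≤ r + 1 is at most ∑ 1 / (q² − 1/4) = 2/3 − 2/(2 r + 3) by telescoping.
∑-inverse-squares : ∀ r n f → (∀ v → v < r → f v * ((2 + v) * (2 + v)) ≤ n) → 3 * (2 * r + 3) * ∑ r f ≤ 4 * r * n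
∑-inverse-squares zero n f h = ≤-reflexive (*-zeroʳ 9)
∑-inverse-squares (suc r) n f h = *-cancelˡ-≤ (2 * r + 3) {{nz}} (begin
  (2 * r + 3) * (3 * (2 * suc r + 3) * (e + A))
    ≡⟨ lem₁ r e A ⟩
  (2 * r + 5) * (3 * (2 * r + 3) * A) + 3 * (4 * (r * r) + 16 * r + 15) * e
    ≤⟨ +-mono-≤ (*-monoʳ-≤ (2 * r + 5) (∑-inverse-squares r n f λ v v<r → h v (m<n⇒m<1+n v<r)))
         -- The slack `3 * e` turns (2 r + 3) (2 r + 5) = 4 (2 + r)² - 1 into 4 (2 + r)².
         (≤-trans (m≤m+n _ (3 * e)) (≤-trans (≤-reflexive (lem₂ r e)) (*-monoʳ-≤ 12 (h r ≤-refl)))) ⟩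
  (2 * r + 5) * (4 * r * n) + 12 * n
    ≡⟨ lem₃ r n ⟩
  (2 * r + 3) * (4 * suc r * n) ∎)
  where
  open ≤-Reasoning
  e = f r
  A = ∑ r f
  nz : NonZero (2 * r + 3)
  nz = >-nonZero (≤-trans (s≤s z≤n) (m≤n+m 3 (2 * r)))
  lem₁ : ∀ r e A → (2 * r + 3) * (3 * (2 * suc r + 3) * (e + A)) ≡ (2 * r + 5) * (3 * (2 * r + 3) * A) + 3 * (4 * (r * r) + 16 * r + 15) * e
  lem₁ = solve-∀
  lem₂ : ∀ r e → 3 * (4 * (r * r) + 16 * r + 15) * e + 3 * e ≡ 12 * (e * ((2 + r) * (2 + r)))
  lem₂ = solve-∀
  lem₃ : ∀ r n → (2 * r + 5) * (4 * r * n) + 12 * n ≡ (2 * r + 3) * (4 * suc r * n)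
  lem₃ = solve-∀

-- Boundary effects cost 1 per class, r in all. The counts lowered by 1 fall under
-- `∑-inverse-squares`, whose factor 4 r / (3 (2 r + 3)) is below 2/3.
∑-square-spaced : ∀ r n f → (∀ v → v < r → f v * ((2 + v) * (2 + v)) ≤ n + (2 + v) * (2 + v)) → 3 * ∑ r f ≤ 2 * n + 3 * r
∑-square-spaced r n f h = begin
  3 * ∑ r f                                  ≤⟨ *-monoʳ-≤ 3 (∑-mono r λ v _ → m≤n+m∸n (f v) 1) ⟩
  3 * ∑ r (λ v → 1 + (f v ∸ 1))              ≡⟨ cong (3 *_) (trans (∑-+ r (λ _ → 1) _) (cong (_+ A) (trans (∑-const r 1) (*-identityʳ r)))) ⟩
  3 * (r + A)                                ≡⟨ lem₀ r A ⟩
  3 * A + 3 * r                              ≤⟨ +-monoˡ-≤ (3 * r) 3A≤ ⟩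
  2 * n + 3 * r                              ∎
  where
  open ≤-Reasoning
  A = ∑ r (λ v → f v ∸ 1)
  lem₀ : ∀ r A → 3 * (r + A) ≡ 3 * A + 3 * r
  lem₀ = solve-∀
  lem₁ : ∀ r A → (2 * r + 3) * (3 * A) ≡ 3 * (2 * r + 3) * A
  lem₁ = solve-∀
  lem₂ : ∀ r n → 4 * r * n + 6 * n ≡ (2 * r + 3) * (2 * n)
  lem₂ = solve-∀
  reduced : ∀ v → v < r → (f v ∸ 1) * ((2 + v) * (2 + v)) ≤ n
  reduced v v<r = begin
    (f v ∸ 1) * s          ≡⟨ *-distribʳ-∸ s (f v) 1 ⟩
    f v * s ∸ 1 * s        ≡⟨ cong (f v * s ∸_) (*-identityˡ s) ⟩
    f v * s ∸ s            ≤⟨ ∸-monoˡ-≤ s (h v v<r) ⟩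
    n + s ∸ s              ≡⟨ m+n∸n≡m n s ⟩
    n                      ∎
    where s = (2 + v) * (2 + v)
  3A≤ : 3 * A ≤ 2 * n
  3A≤ = *-cancelˡ-≤ (2 * r + 3) {{>-nonZero (≤-trans (s≤s z≤n) (m≤n+m 3 (2 * r)))}} (begin
    (2 * r + 3) * (3 * A)  ≡⟨ lem₁ r A ⟩
    3 * (2 * r + 3) * A    ≤⟨ ∑-inverse-squares r n _ reduced ⟩
    4 * r * n              ≤⟨ m≤m+n _ (6 * n) ⟩
    4 * r * n + 6 * n      ≡⟨ lem₂ r n ⟩
    (2 * r + 3) * (2 * n)  ∎)

-- Square factors along an arithmetic progression

-- Turns the witnesses into a total function, as `fibre` expects; from n on it takes the default a₀.
choice-< : ∀ {A : Set} {R : ℕ → A → Set} → A → ∀ n → (∀ i → i < n → ∃ (R i)) → ∃ λ f → ∀ i → i < n → R i (f i)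
choice-< {A} {R} a₀ n witness = f , f-correct
  where
  f : ℕ → A
  f i with i <? n
  ... | yes i<n = proj₁ (witness i i<n)
  ... | no _ = a₀
  f-correct : ∀ i → i < n → R i (f i)
  f-correct i i<n with i <? n
  ... | yes i<n′ = proj₂ (witness i i<n′)
  ... | no i≮n = contradiction i<n i≮n

-- Classes of square factors (2 + r)² with cofactor s: a small root r < Q is its own class,
-- a large one is classified by its cofactor.
colour : ℕ → ℕ → ℕ → ℕ
colour Q r s with r <? Q
... | yes _ = r
... | no _ = Q + s

colour-small : ∀ {Q r s v} → v < Q → colour Q r s ≡ v → r ≡ v
colour-small {Q} {r} {s} v<Q eq with r <? Q
... | yes _ = eq
... | no _ = contradiction (subst (_< Q) (sym eq) v<Q) (m+n≮m Q s)

colour-large : ∀ {Q r s w} → colour Q r s ≡ Q + w → Q ≤ r × s ≡ w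
colour-large {Q} {r} {s} {w} eq with r <? Q
... | yes r<Q = contradiction (subst (_< Q) eq r<Q) (m+n≮m Q w)
... | no r≮Q = ≮⇒≥ r≮Q , +-cancelˡ-≡ Q s w eq

colour-< : ∀ {Q r s} S → (Q ≤ r → s < S) → colour Q r s < S + Q
colour-< {Q} {r} {s} S s<S with r <? Q
... | yes r<Q = ≤-trans r<Q (m≤n+m Q S)
... | no r≮Q = subst (Q + s <_) (+-comm Q S) (+-monoʳ-< Q (s<S (≮⇒≥ r≮Q)))

square-< : ∀ {x y} → x * x < y * y → x < y
square-< {x} {y} h = ≰⇒> λ y≤x → <⇒≱ h (*-mono-≤ y≤x y≤x)

module Progression (a P : ℕ) .{{_ : NonZero P}} where

  term : ℕ → ℕ
  term i = a + P * i

  term-step : ∀ {i j} → i ≤ j → term j ≡ term i + P * (j ∸ i)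
  term-step {i} {j} i≤j = begin
    a + P * j                     ≡⟨ cong (λ z → a + P * z) (m+[n∸m]≡n i≤j) ⟨
    a + P * (i + (j ∸ i))         ≡⟨ cong (a +_) (*-distribˡ-+ P i (j ∸ i)) ⟩
    a + (P * i + P * (j ∸ i))     ≡⟨ +-assoc a _ _ ⟨
    a + P * i + P * (j ∸ i)       ∎
    where open ≡-Reasoning

  -- x divides the difference P (j - i) of the two terms, hence j - i.
  coprime-spaced : ∀ {x i j} → Coprime x P → x ∣ term i → x ∣ term j → i < j → i + x ≤ j
  coprime-spaced {x} {i} {j} cop x∣i x∣j i<j = ≤-trans
    (+-monoʳ-≤ i (∣⇒≤ {{>-nonZero (m<n⇒0<n∸m i<j)}}
      (coprime-divisor cop (∣m+n∣m⇒∣n (subst (x ∣_) (term-step (<⇒≤ i<j)) x∣j) x∣i))))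
    (≤-reflexive (m+[n∸m]≡n (<⇒≤ i<j)))

  -- w y² - w x² ≥ 2 w x ≥ 2 b d ≥ 2 P d, whereas the terms advance by P per index.
  square-multiple-spaced : ∀ {b d w x y i j} → P ≤ b → b * d ≤ x → b * d ≤ y →
    w * (x * x) ≡ term i → w * (y * y) ≡ term j → i < j → i + 2 * d ≤ j
  square-multiple-spaced {b} {d} {w} {x} {y} {i} {j} P≤b Q≤x Q≤y ex ey i<j =
    *-cancelˡ-≤ P (+-cancelˡ-≤ a _ _ (begin
      a + P * (i + 2 * d)             ≡⟨ lem₁ a P i d ⟩
      term i + 2 * (P * d)            ≤⟨ +-monoʳ-≤ (term i) (*-monoʳ-≤ 2 (≤-trans (*-monoˡ-≤ d P≤b) Q≤x)) ⟩
      term i + 2 * x                  ≡⟨ cong (_+ 2 * x) ex ⟨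
      w * (x * x) + 2 * x             ≤⟨ +-monoʳ-≤ (w * (x * x)) (m≤n*m (2 * x) w {{w≢0}}) ⟩
      w * (x * x) + w * (2 * x)       ≤⟨ m≤m+n _ w ⟩
      w * (x * x) + w * (2 * x) + w   ≡⟨ lem₂ w x ⟩
      w * (suc x * suc x)             ≤⟨ *-monoʳ-≤ w (*-mono-≤ x<y x<y) ⟩
      w * (y * y)                     ≡⟨ ey ⟩
      term j                          ∎))
    where
    open ≤-Reasoning
    lem₁ : ∀ a P i d → a + P * (i + 2 * d) ≡ a + P * i + 2 * (P * d)
    lem₁ = solve-∀
    lem₂ : ∀ w x → w * (x * x) + w * (2 * x) + w ≡ w * (suc x * suc x)
    lem₂ = solve-∀
    wx<wy : w * (x * x) < w * (y * y)
    wx<wy = subst₂ _<_ (sym ex) (sym ey) (+-monoʳ-< a (*-monoʳ-< P i<j))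
    w≢0 : NonZero w
    w≢0 = ≢-nonZero λ { refl → <-irrefl refl wx<wy }
    x<y : x < y
    x<y = square-< (*-cancelˡ-< w _ _ wx<wy)

  -- With Q = b d and 12 Q terms, the classes with small root cover at most 8 Q + Q terms. There are at most
  -- 1152 b² + 1 possible cofactors, each covering at most 6 b + 1 terms, which is negligible once d ≫ b².
  square-sieve : ∀ {b d} → P ≤ b → 1 ≤ b → 4096 * (b * b) ≤ d →
    (∀ i → i < 12 * (b * d) → term i ≤ 1152 * (b * b) * ((b * d) * (b * d))) →
    ¬ (∀ i → i < 12 * (b * d) → ∃ λ r → (2 + r) * (2 + r) ∣ term i × Coprime ((2 + r) * (2 + r)) P)
  -- In tripled counts there are 3 T = 36 Q terms. Small roots account for at most 2 T + 3 Q = 27 Q,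
  -- so the large ones would have to cover 9 Q.
  square-sieve {b} {d} P≤b 1≤b b²≤d bounded squares = <⇒≱ too-many (+-cancelˡ-≤ (27 * Q) _ _ (begin
    27 * Q + 9 * Q                                    ≡⟨ lem₁ Q ⟩
    3 * T                                             ≤⟨ *-monoʳ-≤ 3 (≤∑-fibre c T (S + Q) c<) ⟩
    3 * ∑ (S + Q) (λ v → fibre c v T)                 ≡⟨ cong (3 *_) (∑-split Q S _) ⟩
    3 * (∑ Q (λ v → fibre c v T) + ∑ S (λ w → fibre c (Q + w) T))
                                                      ≡⟨ *-distribˡ-+ 3 (∑ Q λ v → fibre c v T) _ ⟩
    3 * ∑ Q (λ v → fibre c v T) + 3 * ∑ S (λ w → fibre c (Q + w) T)
                                                      ≤⟨ +-mono-≤ (∑-square-spaced Q T _ small) (*-monoʳ-≤ 3 large) ⟩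
    2 * T + 3 * Q + 3 * (S * (6 * b + 1))             ≡⟨ lem₂ Q _ ⟩
    27 * Q + 3 * (S * (6 * b + 1))                    ∎))
    where
    open ≤-Reasoning
    Q = b * d
    T = 12 * Q
    S = suc (1152 * (b * b))
    1≤b² : 1 ≤ b * b
    1≤b² = *-mono-≤ 1≤b 1≤b
    1≤d : 1 ≤ d
    1≤d = ≤-trans 1≤b² (≤-trans (m≤n*m (b * b) 4096) b²≤d)
    lem₁ : ∀ Q → 27 * Q + 9 * Q ≡ 3 * (12 * Q)
    lem₁ = solve-∀
    lem₂ : ∀ Q x → 2 * (12 * Q) + 3 * Q + x ≡ 27 * Q + x
    lem₂ = solve-∀
    choose : ∃ λ f → ∀ i → i < T →
      (proj₂ (f i) * ((2 + proj₁ (f i)) * (2 + proj₁ (f i))) ≡ term i) × Coprime ((2 + proj₁ (f i)) * (2 + proj₁ (f i))) P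
    choose = choice-< (0 , 0) T λ i i<T → pack (squares i i<T)
      where
      pack : ∀ {i} → (∃ λ r → (2 + r) * (2 + r) ∣ term i × Coprime ((2 + r) * (2 + r)) P) →
        ∃ λ rs → (proj₂ rs * ((2 + proj₁ rs) * (2 + proj₁ rs)) ≡ term i) × Coprime ((2 + proj₁ rs) * (2 + proj₁ rs)) P
      pack (r , divides s eq , cop) = (r , s) , sym eq , cop
    root cofactor c : ℕ → ℕ
    root i = proj₁ (proj₁ choose i)
    cofactor i = proj₂ (proj₁ choose i)
    c i = colour Q (root i) (cofactor i)
    factored : ∀ i → i < T → cofactor i * ((2 + root i) * (2 + root i)) ≡ term i
    factored i i<T = proj₁ (proj₂ choose i i<T)
    cop : ∀ i → i < T → Coprime ((2 + root i) * (2 + root i)) P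
    cop i i<T = proj₂ (proj₂ choose i i<T)
    Q≤2+ : ∀ {x} → Q ≤ x → Q ≤ 2 + x
    Q≤2+ le = ≤-trans le (m≤n+m _ 2)
    -- A large root has square at least Q², so `bounded` leaves a cofactor of at most 1152 b².
    c< : ∀ i → i < T → c i < S + Q
    c< i i<T = colour-< S λ Q≤r → s≤s (*-cancelʳ-≤ (cofactor i) (1152 * (b * b)) (Q * Q) {{>-nonZero (*-mono-≤ 1≤Q 1≤Q)}}
      (≤-trans (*-monoʳ-≤ (cofactor i) (*-mono-≤ (Q≤2+ Q≤r) (Q≤2+ Q≤r)))
               (≤-trans (≤-reflexive (factored i i<T)) (bounded i i<T))))
      where
      1≤Q : 1 ≤ Q
      1≤Q = *-mono-≤ 1≤b 1≤d
    small : ∀ v → v < Q → fibre c v T * ((2 + v) * (2 + v)) ≤ T + (2 + v) * (2 + v)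
    small v v<Q = fibre-spaced c v T _ spaced
      where
      spaced : ∀ i j → i < j → j < T → c i ≡ v → c j ≡ v → i + (2 + v) * (2 + v) ≤ j
      spaced i j i<j j<T ci cj with colour-small v<Q ci | colour-small v<Q cj
      ... | ri | rj = coprime-spaced
        (subst (λ r → Coprime ((2 + r) * (2 + r)) P) ri (cop i (<-trans i<j j<T)))
        (subst (λ r → (2 + r) * (2 + r) ∣ term i) ri (divides (cofactor i) (sym (factored i (<-trans i<j j<T)))))
        (subst (λ r → (2 + r) * (2 + r) ∣ term j) rj (divides (cofactor j) (sym (factored j j<T))))
        i<j
    large : ∑ S (λ w → fibre c (Q + w) T) ≤ S * (6 * b + 1)
    large = ≤-trans (∑-mono S λ w _ → each w) (≤-reflexive (∑-const S (6 * b + 1)))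
      where
      lem₃ : ∀ b d → 12 * (b * d) + 2 * d ≡ (6 * b + 1) * (2 * d)
      lem₃ = solve-∀
      spaced : ∀ w i j → i < j → j < T → c i ≡ Q + w → c j ≡ Q + w → i + 2 * d ≤ j
      spaced w i j i<j j<T ci cj with colour-large {Q} {root i} ci | colour-large {Q} {root j} cj
      ... | Q≤i , si | Q≤j , sj = square-multiple-spaced {b} {d} {w} P≤b (Q≤2+ Q≤i) (Q≤2+ Q≤j)
        (subst (λ s → s * _ ≡ term i) si (factored i (<-trans i<j j<T)))
        (subst (λ s → s * _ ≡ term j) sj (factored j j<T)) i<j
      each : ∀ w → fibre c (Q + w) T ≤ 6 * b + 1
      each w = *-cancelʳ-≤ _ _ (2 * d) {{>-nonZero (≤-trans 1≤d (m≤n*m d 2))}}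
        (≤-trans (fibre-spaced c (Q + w) T (2 * d) (spaced w)) (≤-reflexive (lem₃ b d)))
    -- Since b ≥ 1 absorbs the lower terms, this comes down to 3 · 1153 · 7 = 24213 < 36864 = 9 ·
    -- 4096, with the 4096 supplied by `b²≤d`.
    too-many : 3 * (S * (6 * b + 1)) < 9 * Q
    too-many = begin-strict
      3 * (S * (6 * b + 1))                     ≤⟨ *-monoʳ-≤ 3 (*-mono-≤ (+-monoˡ-≤ (1152 * (b * b)) 1≤b²) (+-monoʳ-≤ (6 * b) 1≤b)) ⟩
      3 * ((1153 * (b * b)) * (6 * b + b))      ≡⟨ lem₄ b ⟩
      24213 * (b * (b * b))                     <⟨ *-monoˡ-< (b * (b * b)) {{>-nonZero (*-mono-≤ 1≤b 1≤b²)}} (<ᵇ⇒< 24213 36864 _) ⟩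
      36864 * (b * (b * b))                     ≡⟨ lem₅ b (b * b) ⟩
      9 * (b * (4096 * (b * b)))                ≤⟨ *-monoʳ-≤ 9 (*-monoʳ-≤ b b²≤d) ⟩
      9 * Q                                     ∎
      where
      lem₄ : ∀ b → 3 * ((1153 * (b * b)) * (6 * b + b)) ≡ 24213 * (b * (b * b))
      lem₄ = solve-∀
      lem₅ : ∀ b c → 36864 * (b * c) ≡ 9 * (b * (4096 * c))
      lem₅ = solve-∀

-- Prime divisors of n − m

∤⇒coprime-square : ∀ {p x y} → Prime p → ¬ p ∣ y → x ∣ y → Coprime x (p * p)
∤⇒coprime-square {p} pp p∤y x∣y {c} (c∣x , c∣pp) with c ≟ 1
... | yes c≡1 = c≡1
... | no c≢1 = contradiction p∣c λ p∣c → p∤y (∣-trans p∣c (∣-trans c∣x x∣y))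
  where
  p∣c : p ∣ c
  -- If p ∤ c, then c is coprime to p, so c ∣ p² gives c ∣ p and then c = 1.
  p∣c = decidable-stable (p ∣? c) λ p∤c →
    c≢1 (coprime-c-p p∤c (∣-refl , coprime-divisor (coprime-c-p p∤c) c∣pp))
    where
    coprime-c-p : ¬ p ∣ c → Coprime c p
    coprime-c-p p∤c (e∣c , e∣p) = [ id , (λ { refl → contradiction e∣c p∤c }) ]′ (prime⇒irreducible pp e∣p)

+-right-comm : ∀ a b c → a + b + c ≡ a + c + b
+-right-comm = solve-∀

complete-to-multiple : ∀ P n .{{_ : NonZero P}} → ∃ λ j → j ≤ P × P ∣ n + j
-- Residue 0 gives j = P, hence the bound j ≤ P instead of j < P.
complete-to-multiple P n = P ∸ n % P , m∸n≤m P (n % P) , divides (suc (n / P)) (begin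
  n + (P ∸ n % P)                          ≡⟨ cong (_+ (P ∸ n % P)) (m≡m%n+[m/n]*n n P) ⟩
  n % P + n / P * P + (P ∸ n % P)          ≡⟨ +-right-comm (n % P) (n / P * P) (P ∸ n % P) ⟩
  n % P + (P ∸ n % P) + n / P * P          ≡⟨ cong (_+ n / P * P) (m+[n∸m]≡n (m%n≤n n P)) ⟩
  P + n / P * P                            ∎)
  where
  open ≡-Reasoning

-- Keeps all 12 b d terms of the progression within the range of agreement.
index-bound : ∀ {P b d k j} → P ≤ b → j ≤ P → 12 * (b * b) * d ≤ k → ∀ i → i < 12 * (b * d) → j + P * i ≤ k
index-bound {P} {b} {d} {k} {j} P≤b j≤P le i i<T = begin
  j + P * i            ≤⟨ +-monoˡ-≤ (P * i) j≤P ⟩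
  P + P * i            ≡⟨ *-suc P i ⟨
  P * suc i            ≤⟨ *-mono-≤ P≤b i<T ⟩
  b * (12 * (b * d))   ≡⟨ lem b d ⟩
  12 * (b * b) * d     ≤⟨ le ⟩
  k                    ∎
  where
  open ≤-Reasoning
  lem : ∀ b d → b * (12 * (b * d)) ≡ 12 * (b * b) * d
  lem = solve-∀

-- The source of 1152 = 2 · 24²: m + j ≤ 2 k² and k ≤ 24 b² d.
term-bound : ∀ {b d k m j} → m ≤ k * k → j ≤ k → k ≤ 24 * (b * b) * d → m + j ≤ 1152 * (b * b) * ((b * d) * (b * d))
term-bound {b} {d} {k} {m} {j} m≤k² j≤k k≤ = begin
  m + j                                          ≤⟨ +-mono-≤ m≤k² (≤-trans j≤k (k≤k² k)) ⟩
  k * k + k * k                                  ≤⟨ +-mono-≤ (*-mono-≤ k≤ k≤) (*-mono-≤ k≤ k≤) ⟩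
  (24 * (b * b) * d) * (24 * (b * b) * d) + (24 * (b * b) * d) * (24 * (b * b) * d)
                                                 ≡⟨ lem 24 b d ⟩
  2 * (24 * 24) * (b * b) * ((b * d) * (b * d))  ≡⟨⟩
  1152 * (b * b) * ((b * d) * (b * d))           ∎
  where
  open ≤-Reasoning
  k≤k² : ∀ k → k ≤ k * k
  k≤k² zero = z≤n
  k≤k² k@(suc _) = m≤m*n k k
  lem : ∀ c b d → (c * (b * b) * d) * (c * (b * b) * d) + (c * (b * b) * d) * (c * (b * b) * d) ≡ 2 * (c * c) * (b * b) * ((b * d) * (b * d))
  lem = solve-∀

-- The two bounds on k fix the scale: 12 b d steps of size p² ≤ b fit into the range of agreement,
-- while m + j stays small enough to leave few cofactors.
prime-∣-difference : ∀ {k m n b d p} → 1 ≤ m → m ≤ n → n ≤ k * k →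
  1 ≤ b → 4096 * (b * b) ≤ d → 12 * (b * b) * d ≤ k → k ≤ 24 * (b * b) * d →
  (∀ j → j ≤ k → t (m + j) ≡ t (n + j)) → Prime p → p * p ≤ b → p ∣ n ∸ m
prime-∣-difference {k} {m} {n} {b} {d} {p} 1≤m m≤n n≤k² 1≤b b²≤d 12b²d≤k k≤24b²d agree pp P≤b =
  decidable-stable (p ∣? (n ∸ m)) (contradict (complete-to-multiple P n))
  where
  P = p * p
  instance
    p≢0 : NonZero p
    p≢0 = prime⇒nonZero pp
    P≢0 : NonZero P
    P≢0 = m*n≢0 p p
  contradict : (∃ λ j → j ≤ P × P ∣ n + j) → ¬ ¬ p ∣ n ∸ m
  contradict (j₀ , j₀≤P , P∣n+j₀) p∤ = square-sieve {b} {d} P≤b 1≤b b²≤d bounded (squares p∤)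
    where
    open Progression (m + j₀) P
    index : ℕ → ℕ
    index i = j₀ + P * i
    index≤k : ∀ i → i < 12 * (b * d) → index i ≤ k
    index≤k = index-bound {P} {b} {d} {k} {j₀} P≤b j₀≤P 12b²d≤k
    term≡ : ∀ i → term i ≡ m + index i
    term≡ i = +-assoc m j₀ (P * i)
    bounded : ∀ i → i < 12 * (b * d) → term i ≤ 1152 * (b * b) * ((b * d) * (b * d))
    bounded i i<T = subst (_≤ 1152 * (b * b) * ((b * d) * (b * d))) (sym (term≡ i))
      (term-bound {b} {d} (≤-trans m≤n n≤k²) (index≤k i i<T) k≤24b²d)
    P∣n+index : ∀ i → P ∣ n + index i
    P∣n+index i = subst (P ∣_) (+-assoc n j₀ (P * i)) (∣m∣n⇒∣m+n P∣n+j₀ (m∣m*n i))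
    p∤term : ¬ p ∣ n ∸ m → ∀ i → ¬ p ∣ term i
    -- p divides n + `index i`; if it also divided m + `index i`, it would divide n - m.
    p∤term p∤ i p∣term = p∤ (∣m+n∣m⇒∣n (subst (p ∣_) shift (m*n∣⇒m∣ p p (P∣n+index i))) (subst (p ∣_) (term≡ i) p∣term))
      where
      shift : n + index i ≡ m + index i + (n ∸ m)
      shift = trans (cong (_+ index i) (sym (m+[n∸m]≡n m≤n))) (+-right-comm m (n ∸ m) (index i))
    squares : ¬ p ∣ n ∸ m → ∀ i → i < 12 * (b * d) → ∃ λ r → (2 + r) * (2 + r) ∣ term i × Coprime ((2 + r) * (2 + r)) P
    squares p∤ i i<T = extend (square∣-transfer (sym (agree (index i) (index≤k i i<T))) (≤-trans (≤-trans 1≤m m≤n) (m≤m+n n _)) pp (P∣n+index i))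
      where
      extend : (∃ λ r → (2 + r) * (2 + r) ∣ m + index i) → ∃ λ r → (2 + r) * (2 + r) ∣ term i × Coprime ((2 + r) * (2 + r)) P
      extend (r , q²∣) = r , q²∣term , ∤⇒coprime-square pp (p∤term p∤ i) q²∣term
        where
        q²∣term : (2 + r) * (2 + r) ∣ term i
        q²∣term = subst ((2 + r) * (2 + r) ∣_) (sym (term≡ i)) q²∣

-- d is the quotient of k by c. As d ≥ e ≥ 1, the remainder is absorbed by the factor 2.
divide-bracket : ∀ k c e .{{_ : NonZero c}} .{{_ : NonZero e}} → c * e ≤ k → ∃ λ d → e ≤ d × c * d ≤ k × k ≤ 2 * c * d
divide-bracket k c e ce≤k = k / c , e≤d , ≤-trans (≤-reflexive (*-comm c (k / c))) (m/n*n≤m k c) , (begin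
  k                         ≡⟨ m≡m%n+[m/n]*n k c ⟩
  k % c + k / c * c         ≤⟨ +-monoˡ-≤ (k / c * c) (m%n≤n k c) ⟩
  c + k / c * c             ≤⟨ +-monoˡ-≤ (k / c * c) (m≤n*m c (k / c) {{>-nonZero (≤-trans (>-nonZero⁻¹ e) e≤d)}}) ⟩
  k / c * c + k / c * c     ≡⟨ lem (k / c) c ⟩
  2 * c * (k / c)           ∎)
  where
  open ≤-Reasoning
  e≤d : e ≤ k / c
  e≤d = ≤-trans (≤-reflexive (sym (m*n/n≡m e c))) (/-monoˡ-≤ c (≤-trans (≤-reflexive (*-comm e c)) ce≤k))
  lem : ∀ a b → a * b + a * b ≡ 2 * b * a
  lem = solve-∀

-- With b = B² every prime p ≤ B has p² ≤ b. The sieve asks for k ≥ 12 · 4096 b⁴ = 49152 B⁸;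
-- rounding up to 65536 B⁸ makes this a power of 2 whenever B is one.
all-primes-∣-difference : ∀ {k m n B} .{{_ : NonZero B}} → 1 ≤ m → m ≤ n → n ≤ k * k →
  65536 * ((B * B) * (B * B) * ((B * B) * (B * B))) ≤ k →
  (∀ j → j ≤ k → t (m + j) ≡ t (n + j)) → ∀ p → Prime p → p ≤ B → p ∣ n ∸ m
all-primes-∣-difference {k} {m} {n} {B} 1≤m m≤n n≤k² B⁸≤k agree p pp p≤B =
  go (divide-bracket k (12 * (b * b)) (4096 * (b * b)) (≤-trans le B⁸≤k))
  where
  b = B * B
  instance
    b≢0 : NonZero b
    b≢0 = m*n≢0 B B
    b²≢0 : NonZero (b * b)
    b²≢0 = m*n≢0 b b
    12b²≢0 : NonZero (12 * (b * b))
    12b²≢0 = m*n≢0 12 (b * b)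
    4096b²≢0 : NonZero (4096 * (b * b))
    4096b²≢0 = m*n≢0 4096 (b * b)
  le : 12 * (b * b) * (4096 * (b * b)) ≤ 65536 * (b * b * (b * b))
  le = ≤-trans (≤-reflexive ([m*n]*[o*p]≡[m*o]*[n*p] 12 (b * b) 4096 (b * b)))
               (*-monoˡ-≤ (b * b * (b * b)) (≤ᵇ⇒≤ 49152 65536 _))
  go : (∃ λ d → 4096 * (b * b) ≤ d × 12 * (b * b) * d ≤ k × k ≤ 2 * (12 * (b * b)) * d) → p ∣ n ∸ m
  go (d , e≤d , cd≤k , k≤2cd) = prime-∣-difference 1≤m m≤n n≤k² (>-nonZero⁻¹ b) e≤d cd≤k
    (≤-trans k≤2cd (*-monoˡ-≤ d (≤-reflexive (sym (*-assoc 2 12 (b * b)))))) agree pp (*-mono-≤ p≤B p≤B)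

-- Common multiples of initial segments

-- A number e ≤ 2 ^ v has at most v prime factors with multiplicity, each dividing D; removing one
-- at least halves e.
∣-^ : ∀ {D} v {B} → (∀ p → Prime p → p ≤ B → p ∣ D) → 2 ^ v ≤ B → ∀ e → 1 ≤ e → e ≤ 2 ^ v → e ∣ D ^ v
∣-^ zero _ _ (suc zero) _ _ = ∣-refl
∣-^ zero _ _ (suc (suc e)) _ (s≤s ())
∣-^ {D} (suc v) {B} primes∣ 2^v≤B e 1≤e e≤ with 2 ≤? e
... | no ¬2≤e = subst (_∣ D ^ suc v) (≤-antisym 1≤e (s≤s⁻¹ (≰⇒> ¬2≤e))) (1∣ _)
... | yes 2≤e with prime-divisor e 2≤e
...   | p , pp , divides e' refl =
  subst (_∣ D ^ suc v) (*-comm p e')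
    (*-pres-∣ (primes∣ p pp (≤-trans (∣⇒≤ {{>-nonZero 1≤e}} (n∣m*n e')) (≤-trans e≤ 2^v≤B)))
      (∣-^ v primes∣ (≤-trans (m≤m+n _ _) 2^v≤B) e' (n≢0⇒n>0 λ { refl → contradiction 1≤e λ () })
        (*-cancelˡ-≤ 2 (≤-trans (≤-trans (≤-reflexive (*-comm 2 e')) (*-monoʳ-≤ e' (nonTrivial⇒n>1 p {{prime⇒nonTrivial pp}}))) e≤))))

-- binomial a c = (a + c) choose a.
binomial : ℕ → ℕ → ℕ
binomial zero _ = 1
binomial (suc a) zero = 1
binomial (suc a) (suc c) = binomial a (suc c) + binomial (suc a) c

-- The absorption identities. After Pascal's rule each one calls on the other, so they are proved
-- together.
binomial-sucˡ : ∀ a c → suc a * binomial (suc a) c ≡ suc (a + c) * binomial a c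
binomial-sucʳ : ∀ a c → suc c * binomial a (suc c) ≡ suc (a + c) * binomial a c
binomial-sucˡ zero zero = refl
binomial-sucˡ zero (suc c) = trans (*-identityˡ _) (cong (1 +_) (trans (sym (*-identityˡ _)) (binomial-sucˡ zero c)))
binomial-sucˡ (suc a) zero = cong (λ z → suc (suc z) * 1) (sym (+-identityʳ a))
binomial-sucˡ (suc a) (suc c) = begin
  (2 + a) * (x + binomial (2 + a) c)          ≡⟨ *-distribˡ-+ (2 + a) x _ ⟩
  (2 + a) * x + (2 + a) * binomial (2 + a) c  ≡⟨ cong ((2 + a) * x +_) (binomial-sucˡ (suc a) c) ⟩
  (2 + a) * x + suc (suc a + c) * binomial (suc a) c  ≡⟨ cong ((2 + a) * x +_) (binomial-sucʳ (suc a) c) ⟨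
  (2 + a) * x + suc c * x              ≡⟨ lem a c x ⟩
  suc (suc a + suc c) * x              ∎
  where
  open ≡-Reasoning
  x = binomial (suc a) (suc c)
  lem : ∀ a c x → (2 + a) * x + suc c * x ≡ suc (suc a + suc c) * x
  lem = solve-∀
binomial-sucʳ zero c = refl
binomial-sucʳ (suc a) c = begin
  suc c * (binomial a (suc c) + x)           ≡⟨ *-distribˡ-+ (suc c) (binomial a (suc c)) x ⟩
  suc c * binomial a (suc c) + suc c * x     ≡⟨ cong (_+ suc c * x) (trans (binomial-sucʳ a c) (sym (binomial-sucˡ a c))) ⟩
  suc a * x + suc c * x               ≡⟨ lem a c x ⟩
  suc (suc a + c) * x                 ∎
  where
  open ≡-Reasoning
  x = binomial (suc a) c
  lem : ∀ a c x → suc a * x + suc c * x ≡ suc (suc a + c) * x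
  lem = solve-∀

binomial-monoʳ : ∀ a c → binomial a c ≤ binomial a (suc c)
binomial-monoʳ zero c = ≤-refl
binomial-monoʳ (suc a) c = m≤n+m _ _

binomial-monoˡ : ∀ a c → binomial a c ≤ binomial (suc a) c
binomial-monoˡ zero zero = ≤-refl
binomial-monoˡ (suc a) zero = ≤-refl
binomial-monoˡ a (suc c) = m≤m+n _ _

-- Both summands in Pascal's rule for a central coefficient are at least the preceding central one.
2^≤binomial : ∀ h → 2 ^ h ≤ binomial h h
2^≤binomial zero = ≤-refl
2^≤binomial (suc h) = +-mono-≤ (≤-trans (2^≤binomial h) (binomial-monoʳ h h))
  (≤-trans (≤-reflexive (+-identityʳ _)) (≤-trans (2^≤binomial h) (binomial-monoˡ h h)))

-- Leibniz's harmonic triangle: the reciprocals ℓ a c = 1 / ((a + c + 1) binomial a c) satisfy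
-- ℓ a (c + 1) = ℓ a c − ℓ (a + 1) c, so E * ℓ a c is an integer as soon as every E * ℓ a 0 is.
leibniz-∣ : ∀ {E B} → (∀ e → 1 ≤ e → e ≤ B → e ∣ E) → ∀ c a → suc (a + c) ≤ B → suc (a + c) * binomial a c ∣ E
leibniz-∣ {E} {B} all∣ zero a le = subst (_∣ E) (lem a) (all∣ (suc (a + 0)) (s≤s z≤n) le)
  where
  binomial-zeroʳ : ∀ a → binomial a 0 ≡ 1
  binomial-zeroʳ zero = refl
  binomial-zeroʳ (suc a) = refl
  lem : ∀ a → suc (a + 0) ≡ suc (a + 0) * binomial a 0
  lem a rewrite binomial-zeroʳ a = sym (*-identityʳ _)
leibniz-∣ {E} {B} all∣ (suc c) a le
  with leibniz-∣ all∣ c a (≤-trans (s≤s (+-monoʳ-≤ a (n≤1+n c))) le)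
     | leibniz-∣ all∣ c (suc a) (subst (λ z → suc z ≤ B) (+-suc a c) le)
-- x and y are E * ℓ a c and E * ℓ (a + 1) c. Multiplying by c + 1 lets the two absorption
-- identities express both binomials through `F`.
... | divides x ex | divides y ey = divides (x ∸ y) (*-cancelˡ-≡ _ _ (suc c) (sym (begin
  suc c * ((x ∸ y) * (suc (a + suc c) * binomial a (suc c)))  ≡⟨ lem₁ (suc c) (x ∸ y) (suc (a + suc c)) (binomial a (suc c)) ⟩
  suc (a + suc c) * (suc c * binomial a (suc c)) * (x ∸ y)    ≡⟨ cong (λ z → suc (a + suc c) * z * (x ∸ y)) (binomial-sucʳ a c) ⟩
  suc (a + suc c) * F * (x ∸ y)                        ≡⟨ *-distribˡ-∸ (suc (a + suc c) * F) x y ⟩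
  suc (a + suc c) * F * x ∸ suc (a + suc c) * F * y    ≡⟨ cong₂ _∸_ left right ⟩
  suc (a + suc c) * E ∸ suc a * E                      ≡⟨ *-distribʳ-∸ E (suc (a + suc c)) (suc a) ⟨
  (a + suc c ∸ a) * E                                  ≡⟨ cong (_* E) (m+n∸m≡n a (suc c)) ⟩
  suc c * E                                            ∎)))
  where
  open ≡-Reasoning
  F = suc (a + c) * binomial a c
  lem₁ : ∀ c d s m → c * (d * (s * m)) ≡ s * (c * m) * d
  lem₁ = solve-∀
  lem₂ : ∀ a s m y → s * (a * m) * y ≡ a * (y * (s * m))
  lem₂ = solve-∀
  left : suc (a + suc c) * F * x ≡ suc (a + suc c) * E
  left = trans (*-assoc (suc (a + suc c)) F x) (cong (suc (a + suc c) *_) (trans (*-comm F x) (sym ex)))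
  right : suc (a + suc c) * F * y ≡ suc a * E
  right = begin
    suc (a + suc c) * F * y                      ≡⟨ cong (λ z → suc (a + suc c) * z * y) (binomial-sucˡ a c) ⟨
    suc (a + suc c) * (suc a * binomial (suc a) c) * y  ≡⟨ lem₂ (suc a) (suc (a + suc c)) (binomial (suc a) c) y ⟩
    suc a * (y * (suc (a + suc c) * binomial (suc a) c)) ≡⟨ cong (λ z → suc a * (y * (suc z * binomial (suc a) c))) (+-suc a c) ⟩
    suc a * (y * (suc (suc a + c) * binomial (suc a) c)) ≡⟨ cong (suc a *_) ey ⟨
    suc a * E ∎

-- The middle denominator (2 h + 1) * `binomial h h` of Leibniz's triangle divides E.
2^≤common-multiple : ∀ {E B} .{{_ : NonZero E}} → (∀ e → 1 ≤ e → e ≤ B → e ∣ E) → ∀ h → suc (h + h) ≤ B → 2 ^ h ≤ E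
2^≤common-multiple all∣ h le =
  ≤-trans (2^≤binomial h) (≤-trans (m≤n*m (binomial h h) (suc (h + h))) (∣⇒≤ (leibniz-∣ all∣ h h le)))

-- Comparison of the two sizes

n<2^n : ∀ n → n < 2 ^ n
n<2^n zero = s≤s z≤n
n<2^n (suc n) = +-mono-≤ (m^n>0 2 n) (≤-trans (n<2^n n) (m≤m+n _ 0))

m≤n⇒m<2^n : ∀ {m n} → m ≤ n → m < 2 ^ n
m≤n⇒m<2^n {m} m≤n = ≤-trans (n<2^n m) (^-monoʳ-≤ 2 m≤n)

step-bracket : ∀ (g : ℕ → ℕ) {k} N → g 0 ≤ k → k < g N → ∃ λ w → g w ≤ k × k < g (suc w)
step-bracket g zero g0≤k k<g0 = contradiction g0≤k (<⇒≱ k<g0)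
step-bracket g {k} (suc N) g0≤k k<g with g N ≤? k
... | yes gN≤k = N , gN≤k , k<g
... | no gN≰k = step-bracket g N g0≤k (≰⇒> gN≰k)

quadratic<2^ : ∀ w → (16 + w) * (13 + w) < 2 ^ (8 + w)
quadratic<2^ zero = <ᵇ⇒< 208 256 _
quadratic<2^ (suc w) = begin
  suc ((16 + suc w) * (13 + suc w))                        ≤⟨ m≤m+n _ (w * w + 27 * w + 179) ⟩
  suc ((16 + suc w) * (13 + suc w)) + (w * w + 27 * w + 179) ≡⟨ lem w ⟩
  2 * suc ((16 + w) * (13 + w))                            ≤⟨ *-monoʳ-≤ 2 (quadratic<2^ w) ⟩
  2 * 2 ^ (8 + w)                                          ∎
  where
  open ≤-Reasoning
  lem : ∀ w → suc ((16 + suc w) * (13 + suc w)) + (w * w + 27 * w + 179) ≡ 2 * suc ((16 + w) * (13 + w))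
  lem = solve-∀

-- The threshold of `all-primes-∣-difference` at B = 2 ^ u.
2^-eighth : ∀ u → 65536 * ((2 ^ u * 2 ^ u) * (2 ^ u * 2 ^ u) * ((2 ^ u * 2 ^ u) * (2 ^ u * 2 ^ u))) ≡ 2 ^ (16 + 8 * u)
2^-eighth u = sym (begin
  2 ^ (16 + 8 * u)                                        ≡⟨ trans (^-distribˡ-+-* 2 16 (8 * u)) (cong (_* 2 ^ (8 * u)) {2 ^ 16} {65536} refl) ⟩
  65536 * 2 ^ (8 * u)                                     ≡⟨ cong (λ e → 65536 * 2 ^ e) (lem u) ⟩
  65536 * 2 ^ (u + u + (u + u) + (u + u + (u + u)))       ≡⟨ cong (65536 *_) (dbl (u + u + (u + u))) ⟩
  65536 * (2 ^ (u + u + (u + u)) * 2 ^ (u + u + (u + u))) ≡⟨ cong (λ x → 65536 * (x * x)) (trans (dbl (u + u)) (cong (λ x → x * x) (dbl u))) ⟩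
  _                                                       ∎)
  where
  open ≡-Reasoning
  dbl : ∀ e → 2 ^ (e + e) ≡ 2 ^ e * 2 ^ e
  dbl e = ^-distribˡ-+-* 2 e e
  lem : ∀ u → 8 * u ≡ u + u + (u + u) + (u + u + (u + u))
  lem = solve-∀

24+8v-squared : ∀ v → (24 + 8 * suc v + (24 + 8 * suc v)) * suc v ≡ 16 * ((4 + v) * suc v)
24+8v-squared = solve-∀

-- For D = n - m and B = 2 ^ (v + 1), every e from 1 to B divides D ^ (v + 1), so this power is at
-- least 2 ^ (2 ^ v - 1). But D ≤ k² ≤ 2 ^ (2 hi) makes it at most 2 ^ (16 (v + 4) (v + 1)).
no-long-agreement-at-scale : ∀ {k m n} v {lo hi} → lo ≡ 16 + 8 * suc v → hi ≡ 24 + 8 * suc v →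
  16 * ((4 + v) * suc v) < 2 ^ v ∸ 1 → 2 ^ lo ≤ k → k < 2 ^ hi →
  1 ≤ m → m < n → n ≤ k * k → ¬ (∀ j → j ≤ k → t (m + j) ≡ t (n + j))
no-long-agreement-at-scale {k} {m} {n} v {lo} {hi} lo≡ hi≡ v-large 2^lo≤k k<2^hi 1≤m m<n n≤k² agree =
  <⇒≱ (^-monoʳ-< 2 ≤-refl v-large) (begin
    2 ^ (2 ^ v ∸ 1)        ≤⟨ 2^≤common-multiple (∣-^ (suc v) primes∣ ≤-refl) (2 ^ v ∸ 1) fits ⟩
    D ^ suc v              ≤⟨ ^-monoˡ-≤ (suc v) D≤ ⟩
    (2 ^ (hi + hi)) ^ suc v  ≡⟨ ^-*-assoc 2 (hi + hi) (suc v) ⟩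
    2 ^ ((hi + hi) * suc v)  ≡⟨ cong (2 ^_) exponent ⟩
    2 ^ (16 * ((4 + v) * suc v)) ∎)
  where
  open ≤-Reasoning
  D = n ∸ m
  instance
    D≢0 : NonZero D
    D≢0 = >-nonZero (m<n⇒0<n∸m m<n)
    D^u≢0 : NonZero (D ^ suc v)
    D^u≢0 = m^n≢0 D (suc v)
    B≢0 : NonZero (2 ^ suc v)
    B≢0 = m^n≢0 2 (suc v)
  primes∣ : ∀ p → Prime p → p ≤ 2 ^ suc v → p ∣ D
  primes∣ = all-primes-∣-difference {k} {m} {n} {2 ^ suc v} 1≤m (<⇒≤ m<n) n≤k²
    (≤-trans (≤-reflexive (trans (2^-eighth (suc v)) (cong (2 ^_) (sym lo≡)))) 2^lo≤k) agree
  -- 2 ^ v - 1 is the largest h with 2 h + 1 ≤ 2 ^ (v + 1).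
  fits : suc (2 ^ v ∸ 1 + (2 ^ v ∸ 1)) ≤ 2 ^ suc v
  fits = +-mono-≤ {suc (2 ^ v ∸ 1)} (≤-reflexive (m+[n∸m]≡n (m^n>0 2 v))) (≤-trans (m∸n≤m (2 ^ v) 1) (m≤m+n _ 0))
  D≤ : D ≤ 2 ^ (hi + hi)
  D≤ = begin
    n ∸ m           ≤⟨ m∸n≤m n m ⟩
    n               ≤⟨ n≤k² ⟩
    k * k           ≤⟨ *-mono-≤ (<⇒≤ k<2^hi) (<⇒≤ k<2^hi) ⟩
    2 ^ hi * 2 ^ hi   ≡⟨ ^-distribˡ-+-* 2 hi hi ⟨
    2 ^ (hi + hi)     ∎
  exponent : (hi + hi) * suc v ≡ 16 * ((4 + v) * suc v)
  exponent = trans (cong (λ e → (e + e) * suc v) hi≡) (24+8v-squared v)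

no-long-agreement : ∀ k m n → 2 ^ 120 ≤ k → 1 ≤ m → m < n → n ≤ k * k → ¬ (∀ j → j ≤ k → t (m + j) ≡ t (n + j))
no-long-agreement k m n 2^120≤k = at-scale (step-bracket (λ w → 2 ^ exponent w) k 2^120≤k k<)
  where
  -- Scales start at v = 12, the first v with 16 (v + 4) (v + 1) < 2 ^ v - 1, namely 3328 < 4095;
  -- and `exponent 0` is 120.
  exponent : ℕ → ℕ
  exponent w = 16 + 8 * suc (12 + w)
  k< : k < 2 ^ exponent k
  k< = m≤n⇒m<2^n {k} {exponent k} (≤-trans (m≤n+m k 13) (≤-trans (m≤n*m (13 + k) 8) (m≤n+m (8 * (13 + k)) 16)))
  large : ∀ w → 16 * ((16 + w) * suc (12 + w)) < 2 ^ (12 + w) ∸ 1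
  -- The summand 2 pays for the strict inequality and for the subtracted 1.
  large w = ∸-monoˡ-≤ {2 + 16 * ((16 + w) * suc (12 + w))} {2 ^ (12 + w)} 1 (begin
    2 + 16 * q            ≤⟨ +-monoˡ-≤ (16 * q) (≤ᵇ⇒≤ 2 16 _) ⟩
    16 + 16 * q           ≡⟨ *-suc 16 q ⟨
    16 * suc q            ≤⟨ *-monoʳ-≤ 16 (quadratic<2^ w) ⟩
    16 * 2 ^ (8 + w)      ≡⟨ ^-distribˡ-+-* 2 4 (8 + w) ⟨
    2 ^ (4 + (8 + w))     ≡⟨ cong (2 ^_) (+-assoc 4 8 w) ⟨
    2 ^ (12 + w)          ∎)
    where
    open ≤-Reasoning
    q = (16 + w) * (13 + w)
  next : ∀ w → exponent (suc w) ≡ 24 + 8 * suc (12 + w)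
  next w = trans (cong (16 +_) (trans (cong (8 *_) (+-suc 13 w)) (*-suc 8 (13 + w)))) (sym (+-assoc 16 8 _))
  at-scale : (∃ λ w → 2 ^ exponent w ≤ k × k < 2 ^ exponent (suc w)) →
    1 ≤ m → m < n → n ≤ k * k → ¬ (∀ j → j ≤ k → t (m + j) ≡ t (n + j))
  at-scale (w , lo , hi) = no-long-agreement-at-scale {k} {m} {n} (12 + w) {exponent w} {exponent (suc w)} refl (next w) (large w) lo hi

-- Since n ≥ 2, the logarithm is at least 1 and X ≥ n ≥ 1. If k² exceeded K² X, then k > K and n ≤ X
-- < k², which `none` excludes.
square-bound-from-threshold : ∀ K .{{_ : NonZero K}} {A : ℕ → ℕ → ℕ → Set} →
  (∀ k m n → K ≤ k → 1 ≤ m → m < n → n ≤ k * k → ¬ A k m n) →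
  ∀ k m n → 1 ≤ m → 2 ≤ n → 2 * m ≤ n → A k m n → k * k ≤ K * K * (n * (⌊log₂ n ⌋ ^ 3))
square-bound-from-threshold K none k m n 1≤m 2≤n 2m≤n agree =
  decidable-stable (k * k ≤? K * K * X) λ ≰ →
    none k m n
      (<⇒≤ (square-< (≤-<-trans (m≤m*n (K * K) X) (≰⇒> ≰)))) 1≤m
      (≤-trans (+-mono-≤ 1≤m (m≤m+n m 0)) 2m≤n)
      (≤-trans (≤-trans (m≤m*n n (⌊log₂ n ⌋ ^ 3)) (m≤n*m X (K * K))) (<⇒≤ (≰⇒> ≰))) agree
  where
  X = n * (⌊log₂ n ⌋ ^ 3)
  instance
    n≢0 : NonZero n
    n≢0 = >-nonZero (≤-trans (n≤1+n 1) 2≤n)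
    log≢0 : NonZero ⌊log₂ n ⌋
    log≢0 = >-nonZero (≤-trans (≤-reflexive (sym (⌊log₂[2^n]⌋≡n 1))) (⌊log₂⌋-mono-≤ 2≤n))
    log³≢0 : NonZero (⌊log₂ n ⌋ ^ 3)
    log³≢0 = m^n≢0 ⌊log₂ n ⌋ 3
    X≢0 : NonZero X
    X≢0 = m*n≢0 n (⌊log₂ n ⌋ ^ 3)
    K²≢0 : NonZero (K * K)
    K²≢0 = m*n≢0 K K

-- The bound is squared to stay within ℕ. For n ≥ 2, ⌊log₂ n⌋ and log n agree up to constant
-- factors.
theorem11 : ∃ λ (C : ℕ) → ∀ (k m n : ℕ) → 1 ≤ k → 1 ≤ m → 2 ≤ n → 2 * m ≤ n →
    (∀ (j : ℕ) → j ≤ k → t (m + j) ≡ t (n + j)) →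
    k * k ≤ C * (n * (⌊log₂ n ⌋ ^ 3))
theorem11 = 2 ^ 120 * 2 ^ 120 , λ k m n _ → square-bound-from-threshold (2 ^ 120) {{m^n≢0 2 120}} no-long-agreement k m n
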